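{- There exists a family of strings on which $\nu = o(\min(\ell,b))$. That is, there is an infinite set $\mathcal{F}'$ of strings such that $\nu(w)=o\big(\min(\ell(w),b(w))\big)$ for $w\in\mathcal{F}'$, as $|w|\to\infty$.
   Context: A string family is an infinite set of finite strings of unbounded length; asymptotic notation on a family refers to strings $w$ of the family with $n=|w|\to\infty$ (with constants uniform over the family). $w[i:j]$ denotes the substring of $w$ from position $i$ to position $j$ (positions start at 1), and $w[:j]=w[1:j]$. L-systems: an L-system is a tuple $(\Sigma,\varphi,\tau,s,d,n)$, where $\Sigma$ is a finite alphabet, $\varphi:\Sigma^*\to\Sigma^*$ is a non-erasing monoid endomorphism (each rule $a\to\varphi(a)$, $a\in\Sigma$, has $|\varphi(a)|\ge 1$), $\tau:\Sigma^*\to\Sigma^*$ is a coding (a morphism with $|\tau(a)|=1$ for all $a\in\Sigma$), $s\in\Sigma^+$ is the axiom, and $d\ge 0$, $n\ge 1$ are integers. It generates the unique string $\tau(\varphi^d(s))[1:n]$ of length $n$. It is always assumed that $d=n^{O(1)}$ and $|\Sigma|=n^{O(1)}$ (each value fits in an $O(\log n)$-bit word). The size of the L-system is $\sum_{a\in\Sigma}|\varphi(a)|+|s|+|\Sigma|+2$. The measure $\ell(w)$ is the size of the smallest L-system generating $w$. Macro-schemes: a bidirectional macro-scheme for $w$ is a factorization of $w$ into non-empty phrases where each phrase of length greater than 1 is assigned a copy (source occurrence in $w$) starting at a different position, and phrases of length 1 may be stored explicitly, so that $w$ can be recovered by following the induced position-to-position pointers (i.e. the pointers have no cycles). $b(w)$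 is the smallest number of phrases of a bidirectional macro-scheme for $w$. NU-systems: a NU-system is a tuple $(V,R,\tau,s,d,n)$ generating a unique string of length $n$ in the way an L-system does ($V$ the alphabet, $R$ the rules, one per symbol of $V$ with non-empty right-hand side, $\tau$ a coding, $s$ the axiom, $d$ the level, $n$ the prefix length), except that right-hand sides of rules and the axiom may also contain special extraction symbols $a(k)[i:j]$ with $a\in V$. The meaning of $a(k)[i:j]$ is: generate the $k$-th level starting from $a$, extract from it the substring from position $i$ to position $j$, and apply the coding $\tau$ to that substring. One step from a level to the next replaces each ordinary symbol by the right-hand side of its rule and each extraction symbol by the string it denotes; extraction symbols remaining in the level from which a string is extracted, or in the final level $d$, are likewise replaced by the strings they denote. The generated string is the length-$n$ prefix of the image under $\tau$ of the $d$-th level from $s$. The indexes inside a NU-system (levels, interval endpoints) must be at most $n$. The system must be free of loops: determining the symbols of the extracted substrings and of the output prefix must not lead to circular dependencies. The size of a NU-system is $\sum_{a\in V}|R(a)|+|s|+|V|+2$, where each extraction symbol counts as having length 4. $\nu(w)$ is the size of the smallest NU-system generating $w$. -}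

module Defs where

open import Data.Fin using (Fin; toℕ)
open import Data.List using (List; []; _∷_; _++_; length; lookup; map; concatMap; take; drop; allFin)
open import Data.List.Membership.Propositional using (_∈_)
open import Data.List.NonEmpty as List⁺ using (List⁺; toList)
open import Data.Maybe using (Maybe; just; nothing)
open import Data.Nat using (ℕ; zero; suc; _+_; _*_; _∸_; _^_; _≤_; _<_; _⊓_)
open import Data.Nat.ListAction using (sum)
open import Data.Product using (∃-syntax; _×_; _,_; proj₁)
open import Data.Sum using (_⊎_)
open import Data.Unit using (⊤)
open import Function using (_∘_)
open import Function.Definitions using (Injective)
open import Relation.Binary.Construct.Closure.Transitive using (TransClosure)
open import Relation.Binary.PropositionalEquality using (_≡_; _≢_)
open import Relation.Nullary using (¬_)

-- All symbols are drawn from ℕ; an alphabet is a finite subset of ℕ, given as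
-- an injection from some Fin m.
Word : Set
Word = List ℕ

-- A word measure, as the graph of a partial function.
Measure : Set₁
Measure = Word → ℕ → Set

IsMinimum : {A : Set} → (A → Set) → (A → ℕ) → ℕ → Set
IsMinimum P size m = (∃[ x ] P x × size x ≡ m) × (∀ x → P x → m ≤ size x)

------------------------------------------------------------------------
-- L-systems

record LSystem : Set where
  field
    σ              : ℕ
    name           : Fin σ → ℕ
    name-injective : Injective _≡_ _≡_ name
    φ              : Fin σ → List⁺ (Fin σ)
    τ              : Fin σ → Fin σ
    axiom          : List⁺ (Fin σ)
    d              : ℕ
    n              : ℕ
    n≥1            : 1 ≤ n

  φ* : List (Fin σ) → List (Fin σ)
  φ* = concatMap (toList ∘ φ)

  level : ℕ → List (Fin σ)
  level zero    = toList axiom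
  level (suc k) = φ* (level k)

  size : ℕ
  size = sum (map (List⁺.length ∘ φ) (allFin σ)) + List⁺.length axiom + σ + 2

  Generates : Word → Set
  Generates w = n ≤ length (level d) × map (name ∘ τ) (take n (level d)) ≡ w

  -- d and σ are n^O(1), the hidden constants being majorised by K.
  PolyBounded : ℕ → Set
  PolyBounded K = d ≤ K * n ^ K × σ ≤ K * n ^ K

ℓ : ℕ → Measure
ℓ K w = IsMinimum (λ L → LSystem.PolyBounded L K × LSystem.Generates L w) LSystem.size

------------------------------------------------------------------------
-- Bidirectional macro-schemes

-- A phrase is its content together with the position of its copy, or nothing
-- if it is stored explicitly.  In this section positions start at 0.
Phrase : Set
Phrase = List⁺ ℕ × Maybe ℕ

contents : List Phrase → Word
contents = concatMap (toList ∘ proj₁)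

PhraseAt : List Phrase → ℕ → Phrase → Set
PhraseAt ps p f = ∃[ before ] ∃[ after ] ps ≡ before ++ f ∷ after × length (contents before) ≡ p

Pointer : List Phrase → ℕ → ℕ → Set
Pointer ps x y =
  ∃[ p ] ∃[ f ] ∃[ q ] ∃[ o ]
    PhraseAt ps p (f , just q) × o < List⁺.length f × x ≡ p + o × y ≡ q + o

record MacroScheme (w : Word) : Set where
  field
    phrases       : List Phrase
    factorization : contents phrases ≡ w
    explicit      : ∀ {p f} → PhraseAt phrases p (f , nothing) → List⁺.length f ≡ 1
    copy          : ∀ {p f q} → PhraseAt phrases p (f , just q) →
                    q ≢ p × take (List⁺.length f) (drop q w) ≡ toList f
    acyclic       : ∀ x → ¬ TransClosure (Pointer phrases) x x

  size : ℕ
  size = length phrases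

b : Measure
b w = IsMinimum {MacroScheme w} (λ _ → ⊤) MacroScheme.size

------------------------------------------------------------------------
-- NU-systems

-- extract a k i j is the extraction symbol a(k)[i:j].
data Item (v : ℕ) : Set where
  symbol  : Fin v → Item v
  extract : (a : Fin v) (k i j : ℕ) → Item v

itemSize : ∀ {v} → Item v → ℕ
itemSize (symbol _)        = 1
itemSize (extract _ _ _ _) = 4

rhsSize : ∀ {v} → List⁺ (Item v) → ℕ
rhsSize = sum ∘ map itemSize ∘ toList

-- Levels are described one position at a time, by an inductive definition: a
-- symbol is determined by a (finite) derivation exactly when following what it
-- depends on does not lead into a loop.
module Semantics {v : ℕ} (R : Fin v → List⁺ (Item v)) (τ : Fin v → Fin v) where

  -- When a step replaces an extraction symbol, the number of symbols it denotes
  -- is known but the symbols need not be.  extracted a k x stands for the one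
  -- ordinary symbol a(k)[x:x], which is determined only where it is needed.
  data Cell : Set where
    item      : Item v → Cell
    extracted : (a : Fin v) (k x : ℕ) → Cell

  -- The number of symbols of a cell once extraction symbols are replaced.
  width : Cell → ℕ
  width (item (symbol _))        = 1
  width (item (extract _ _ i j)) = suc j ∸ i
  width (extracted _ _ _)        = 1

  -- CellAt u k q c: in the k-th level from u, the cell preceded by exactly q
  -- cells is c.
  data CellAt (u : List (Item v)) : ℕ → ℕ → Cell → Set

  -- NextOffset u k q p: the first q cells of level k yield the first p cells
  -- of level k + 1.
  data NextOffset (u : List (Item v)) (k : ℕ) : ℕ → ℕ → Set

  -- FinalOffset u k q p: the first q cells of level k yield p symbols once
  -- extraction symbols are replaced.
  data FinalOffset (u : List (Item v)) (k : ℕ) : ℕ → ℕ → Set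

  -- SymbolAt u k x a: position x (starting at 1) of the k-th level from u,
  -- with the remaining extraction symbols replaced, holds a.
  data SymbolAt (u : List (Item v)) (k : ℕ) : ℕ → Fin v → Set

  -- The cell is, or stands for, the ordinary symbol.
  data IsSymbol : Cell → Fin v → Set

  data CellAt u where
    start     : (o : Fin (length u)) → CellAt u zero (toℕ o) (item (lookup u o))
    rewritten : ∀ {k q p c a} → NextOffset u k q p → CellAt u k q c → IsSymbol c a →
              (o : Fin (length (toList (R a)))) →
              CellAt u (suc k) (p + toℕ o) (item (lookup (toList (R a)) o))
    replaced  : ∀ {k q p a l i j o} → NextOffset u k q p →
              CellAt u k q (item (extract a l i j)) → o < suc j ∸ i →
              CellAt u (suc k) (p + o) (extracted a l (i + o))

  data NextOffset u k where
    none      : NextOffset u k 0 0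
    rewritten : ∀ {q p c a} → NextOffset u k q p → CellAt u k q c → IsSymbol c a →
              NextOffset u k (suc q) (p + List⁺.length (R a))
    replaced  : ∀ {q p a l i j} → NextOffset u k q p →
              CellAt u k q (item (extract a l i j)) →
              NextOffset u k (suc q) (p + (suc j ∸ i))

  data FinalOffset u k where
    none : FinalOffset u k 0 0
    more : ∀ {q p c} → FinalOffset u k q p → CellAt u k q c →
           FinalOffset u k (suc q) (p + width c)

  data SymbolAt u k where
    kept     : ∀ {q p c a} → FinalOffset u k q p → CellAt u k q c → IsSymbol c a →
               SymbolAt u k (suc p) a
    replaced : ∀ {q p a l i j o a′} → FinalOffset u k q p →
               CellAt u k q (item (extract a l i j)) → o < suc j ∸ i →
               IsSymbol (extracted a l (i + o)) a′ →
               SymbolAt u k (suc (p + o)) a′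

  data IsSymbol where
    ordinary  : ∀ {a} → IsSymbol (item (symbol a)) a
    extracted : ∀ {a k x c} → SymbolAt (symbol a ∷ []) k x c →
                IsSymbol (extracted a k x) (τ c)

record NUSystem : Set where
  field
    v              : ℕ
    name           : Fin v → ℕ
    name-injective : Injective _≡_ _≡_ name
    R              : Fin v → List⁺ (Item v)
    τ              : Fin v → Fin v
    axiom          : List⁺ (Item v)
    d              : ℕ
    n              : ℕ
    n≥1            : 1 ≤ n

  open Semantics R τ public

  Occurs : Item v → Set
  Occurs e = e ∈ toList axiom ⊎ ∃[ a ] e ∈ toList (R a)

  field
    d≤n      : d ≤ n
    indexes  : ∀ {a k i j} → Occurs (extract a k i j) → k ≤ n × 1 ≤ i × i ≤ j × j ≤ n
    loopFree : ∀ {a k i j} → Occurs (extract a k i j) →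
               ∀ x → i ≤ x → x ≤ j → ∃[ c ] SymbolAt (symbol a ∷ []) k x c

  size : ℕ
  size = sum (map (rhsSize ∘ R) (allFin v)) + rhsSize axiom + v + 2

  -- This includes loop-freeness for the output prefix.
  Generates : Word → Set
  Generates w = length w ≡ n ×
    ((x : Fin (length w)) →
       ∃[ c ] SymbolAt (toList axiom) d (suc (toℕ x)) c × lookup w x ≡ name (τ c))

ν : Measure
ν w = IsMinimum (λ N → NUSystem.Generates N w) NUSystem.size

------------------------------------------------------------------------
-- String families and asymptotics

IsStringFamily : (Word → Set) → Set
IsStringFamily F = ∀ m → ∃[ w ] F w × m ≤ length w

minᴹ : Measure → Measure → Measure
minᴹ f g w m = ∃[ x ] ∃[ y ] f w x × g w y × m ≡ x ⊓ y

-- f = o(g) on the family F.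
LittleO : (Word → Set) → Measure → Measure → Set
LittleO F f g = ∀ c → ∃[ n₀ ] (∀ w → F w → n₀ ≤ length w →
                  ∀ x y → f w x → g w y → c * x ≤ y)

{-# OPTIONS --safe #-}
module Submission where

-- The words are b cᵉ b cᵉ′ ⋯ with exponents m−1, …, 1, 0 followed by t further exponents ≥ m.
-- A NU-system of size 4t + 14 produces them: the first m blocks are a prefix of a(m) under
-- a → ba, b → bc, c → c, and each further block is b(k)[1:k+1].  Each of the first m factors
-- b cᵉ b occurs only once, so no phrase of a macro-scheme contains it, and more than m phrases
-- are needed.  An L-system of bounded size is determined, up to finitely many choices, by its
-- level and prefix length, so for t large compared with K there are fewer words of small ℓ than
-- choices of t exponents below a large N, and some choice forces ℓ ≥ m.  Finally m is chosen
-- as T (4t + 14) + 1 with T → ∞.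

open import Defs
open import Data.Empty using (⊥-elim)
open import Data.Fin using (Fin; zero; suc; toℕ; finToFun; funToFin; combine)
open import Data.Fin.Patterns using (0F; 1F; 2F)
open import Data.Fin.Properties using (toℕ-injective; toℕ<n; any?; pigeonhole; funToFin-finToFin)
open import Data.List using (List; []; _∷_; [_]; _++_; length; lookup; map; concatMap; take; drop;
  replicate; downFrom; upTo; allFin; tabulate; cartesianProduct; cartesianProductWith)
open import Data.List.Membership.Propositional using (_∈_; _∉_; lose)
open import Data.List.Membership.Propositional.Properties
import Data.List.Membership.DecPropositional as DecMembership
import Data.List.Membership.Setoid.Properties as Membership
open import Data.List.NonEmpty as List⁺ using (List⁺; toList; _∷_)
open import Data.List.Properties
open import Data.List.Relation.Unary.All as All using (All; []; _∷_)
import Data.List.Relation.Unary.All.Properties as All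
open import Data.List.Relation.Unary.Any as Any using (here; there)
open import Data.List.Reverse using (Reverse; []; _∶_∶ʳ_; reverseView)
open import Data.Maybe using (just; nothing)
open import Data.Nat using (ℕ; zero; suc; _+_; _*_; _∸_; _^_; _⊓_; _≤_; _<_; z≤n; s≤s; _≟_; NonZero; >-nonZero)
open import Data.Nat.GeneralisedArithmetic using (fold; fold-+)
open import Data.Nat.ListAction using (sum)
open import Data.Nat.Properties hiding (_≟_)
open import Data.Product using (∃-syntax; ∃₂; Σ-syntax; _×_; _,_; proj₁; proj₂; map₁; uncurry)
open import Data.Sum using (inj₁; inj₂)
open import Data.Vec as Vec using (Vec; []; _∷_)
import Data.Vec.Properties as Vec
open import Function using (_∘_; id)
open import Relation.Binary.PropositionalEquality
  using (_≡_; _≢_; _≗_; refl; sym; trans; cong; cong₂; subst; subst₂; setoid; module ≡-Reasoning)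
open import Relation.Nullary using (¬_; Dec; yes; no; ¬?; decidable-stable)

-- Prefixes and suffixes of concatenated lists.

++-factor : ∀ {A : Set} (xs ys : List A) {us vs} → xs ++ us ≡ ys ++ vs → length ys ≤ length xs →
            ∃[ zs ] xs ≡ ys ++ zs
++-factor xs       []       eq le       = xs , refl
++-factor (x ∷ xs) (y ∷ ys) eq (s≤s le) with refl , eq′ ← ∷-injective eq
  with zs , refl ← ++-factor xs ys eq′ le = zs , refl

drop-++-≤ : ∀ {A : Set} n (xs : List A) {ys} → n ≤ length xs → drop n (xs ++ ys) ≡ drop n xs ++ ys
drop-++-≤ zero    xs       _        = refl
drop-++-≤ (suc n) (x ∷ xs) (s≤s le) = drop-++-≤ n xs le

drop-length-++ : ∀ {A : Set} (xs : List A) {ys} → drop (length xs) (xs ++ ys) ≡ ys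
drop-length-++ []       = refl
drop-length-++ (x ∷ xs) = drop-length-++ xs

-- Words made of blocks `b cᵉ`, and where their factors occur.

runs : {A : Set} → A → A → List ℕ → List A
runs b c = concatMap (λ e → b ∷ replicate e c)

map-runs : ∀ {A B : Set} (f : A → B) b c es → map f (runs b c es) ≡ runs (f b) (f c) es
map-runs f b c es = trans (map-concatMap f _ es)
  (concatMap-cong (λ e → cong (f b ∷_) (map-replicate f e c)) es)

length-runs-≥ : ∀ {A : Set} {b c : A} es → length es ≤ length (runs b c es)
length-runs-≥ []       = z≤n
length-runs-≥ {b = b} {c} (e ∷ es) = s≤s (≤-trans (length-runs-≥ es) (length-++-≤ʳ (runs b c es) {replicate e c}))

length-runs-≤ : ∀ {A : Set} {b c : A} {m} es → All (_< m) es → length (runs b c es) ≤ length es * m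
length-runs-≤ [] [] = z≤n
length-runs-≤ {b = b} {c} {m} (e ∷ es) (e<m ∷ es<m) = begin
  suc (length (replicate e c ++ runs b c es))          ≡⟨ cong suc (length-++ (replicate e c)) ⟩
  suc (length (replicate e c)) + length (runs b c es)  ≡⟨ cong (λ l → suc l + length (runs b c es)) (length-replicate e) ⟩
  suc e + length (runs b c es)                         ≤⟨ +-mono-≤ e<m (length-runs-≤ es es<m) ⟩
  m + length es * m                                    ∎
  where open ≤-Reasoning

module _ {A : Set} {b c : A} (b≢c : b ≢ c) where

  runs-not-c : ∀ es {ws} → runs b c es ≢ c ∷ ws
  runs-not-c (_ ∷ _) eq = b≢c (∷-injectiveˡ eq)

  first-run : ∀ e es e′ {ws} → replicate e c ++ runs b c es ≡ replicate e′ c ++ b ∷ ws → e ≡ e′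
  first-run zero    es       zero     eq = refl
  first-run zero    es       (suc e′) eq = ⊥-elim (runs-not-c es eq)
  first-run (suc e) es       zero     eq = ⊥-elim (b≢c (sym (∷-injectiveˡ eq)))
  first-run (suc e) es       (suc e′) eq = cong suc (first-run e es e′ (∷-injectiveʳ eq))

  -- Every `b` opens a new block, so the exponents can be read off from the word. The counting of
  -- words relies on this: different choices of exponents give different words.
  runs-injective : ∀ es es′ → runs b c es ≡ runs b c es′ → es ≡ es′
  runs-injective []       []         eq = refl
  runs-injective (e ∷ es) (e′ ∷ es′) eq = uncurry (cong₂ _∷_) (go e e′ (∷-injectiveʳ eq))
    where
    go : ∀ e e′ → replicate e c ++ runs b c es ≡ replicate e′ c ++ runs b c es′ → e ≡ e′ × es ≡ es′
    go zero    zero     eq = refl , runs-injective es es′ eq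
    go zero    (suc e′) eq = ⊥-elim (runs-not-c es eq)
    go (suc e) zero     eq = ⊥-elim (runs-not-c es′ (sym eq))
    go (suc e) (suc e′) eq = map₁ (cong suc) (go e e′ (∷-injectiveʳ eq))

  beyond-run : ∀ e {ws zs} y → drop y (replicate e c ++ ws) ≡ b ∷ zs →
               ∃[ y′ ] y ≡ e + y′ × drop y′ ws ≡ b ∷ zs
  beyond-run zero    y       eq = y , refl , eq
  beyond-run (suc e) zero    eq = ⊥-elim (b≢c (sym (∷-injectiveˡ eq)))
  beyond-run (suc e) (suc y) eq with y′ , refl , eq′ ← beyond-run e y eq = y′ , refl , eq′

  -- A factor starting with `b` starts where some block opens, and its second `b` forces the
  -- exponent of that block to be exactly `e` and not larger.
  occurrence : ∀ es y e {ws} → drop y (runs b c es) ≡ b ∷ replicate e c ++ b ∷ ws →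
               ∃₂ λ pre post → es ≡ pre ++ e ∷ post × y ≡ length (runs b c pre)
  occurrence []       y e eq with () ← trans (sym (drop-[] y)) eq
  occurrence (f ∷ es) zero e eq with refl ← first-run f es e (∷-injectiveʳ eq) = [] , es , refl , refl
  occurrence (f ∷ es) (suc y) e eq
    with y′ , refl , eq′ ← beyond-run f y eq
    with pre , post , refl , refl ← occurrence es y′ e eq′
    = f ∷ pre , post , refl , cong suc (begin
        f + length (runs b c pre)                      ≡⟨ cong (_+ length (runs b c pre)) (length-replicate f) ⟨
        length (replicate f c) + length (runs b c pre) ≡⟨ length-++ (replicate f c) ⟨
        length (replicate f c ++ runs b c pre)         ∎)
    where open ≡-Reasoning

  -- If the prefixes had different lengths, the `e` that follows `pre′` would lie in `post` or in
  -- `pre`.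
  decomposition-unique : ∀ (pre pre′ : List ℕ) {e post post′} → e ∉ pre → e ∉ post →
                         pre ++ e ∷ post ≡ pre′ ++ e ∷ post′ → pre ≡ pre′
  decomposition-unique []        []         _ _ _ = refl
  decomposition-unique []        (_ ∷ pre′) _ e∉post eq with refl , refl ← ∷-injective eq =
    ⊥-elim (e∉post (∈-++⁺ʳ pre′ (here refl)))
  decomposition-unique (_ ∷ _)   []         e∉pre _ eq with refl , refl ← ∷-injective eq =
    ⊥-elim (e∉pre (here refl))
  decomposition-unique (_ ∷ pre) (_ ∷ pre′) e∉pre e∉post eq with refl , eq′ ← ∷-injective eq =
    cong (_ ∷_) (decomposition-unique pre pre′ (e∉pre ∘ there) e∉post eq′)

  occurrence-unique : ∀ pre e {post} y {ws} → e ∉ pre → e ∉ post →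
                      drop y (runs b c (pre ++ e ∷ post)) ≡ b ∷ replicate e c ++ b ∷ ws →
                      y ≡ length (runs b c pre)
  occurrence-unique pre e {post} y e∉pre e∉post eq
    with pre′ , _ , eq′ , refl ← occurrence (pre ++ e ∷ post) y e eq
    = cong (length ∘ runs b c) (sym (decomposition-unique pre pre′ e∉pre e∉post eq′))

-- Lower bound for macro-schemes.

module _ {b c : ℕ} (b≢c : b ≢ c) where

  -- The copy of a phrase containing a factor b cᵉ b that occurs only once would contain it again.
  phrase-ends : ∀ {w pre e e′ post before f after} (m : MacroScheme w) → w ≡ runs b c (pre ++ e ∷ e′ ∷ post) →
    e ∉ pre → e ∉ e′ ∷ post → MacroScheme.phrases m ≡ before ++ f ∷ after →
    length (contents before) ≤ length (runs b c pre) →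
    length (contents before) + List⁺.length (proj₁ f) ≤ length (runs b c pre) + suc e
  phrase-ends {w} {pre} {e} {e′} {post} {before} {f , source} {after} m w≡runs e∉pre e∉post ps≡ p≤ =
    ≮⇒≥ (λ long → cannot-copy source refl long)
    where
    open MacroScheme m
    open ≡-Reasoning
    p   = length (contents before)
    x   = length (runs b c pre)
    -- `win` is the factor that occurs only once, starting at position `x`; `X` is the part of `w`
    -- from the start `p` of the phrase up to `x`.
    win = b ∷ replicate e c ++ [ b ]
    rest = replicate e′ c ++ runs b c post
    X   = drop p (runs b c pre)

    |win| : length win ≡ suc e + 1
    |win| = cong suc (trans (length-++ (replicate e c)) (cong (_+ 1) (length-replicate e)))

    w≡ : w ≡ runs b c pre ++ win ++ rest
    w≡ = begin
      w ≡⟨ w≡runs ⟩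
      runs b c (pre ++ e ∷ e′ ∷ post) ≡⟨ concatMap-++ _ pre (e ∷ e′ ∷ post) ⟩
      runs b c pre ++ b ∷ replicate e c ++ b ∷ rest ≡⟨ cong (λ z → runs b c pre ++ b ∷ z) (++-assoc (replicate e c) [ b ] rest) ⟨
      runs b c pre ++ win ++ rest ∎

    |X| : length X ≡ x ∸ p
    |X| = length-drop p (runs b c pre)

    factor : x + suc e < p + List⁺.length f → ∃[ Y ] toList f ≡ (X ++ win) ++ Y
    factor long = ++-factor (toList f) (X ++ win) {contents after} {rest} (begin
        toList f ++ contents after ≡⟨ drop-length-++ (contents before) ⟨
        drop p (contents before ++ contents ((f , source) ∷ after)) ≡⟨ cong (drop p) (concatMap-++ _ before ((f , source) ∷ after)) ⟨
        drop p (contents (before ++ (f , source) ∷ after)) ≡⟨ cong (drop p ∘ contents) ps≡ ⟨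
        drop p (contents phrases) ≡⟨ cong (drop p) (trans factorization w≡) ⟩
        drop p (runs b c pre ++ win ++ rest) ≡⟨ drop-++-≤ p (runs b c pre) p≤ ⟩
        X ++ win ++ rest ≡⟨ ++-assoc X win rest ⟨
        (X ++ win) ++ rest ∎)
      -- `win` includes the `b` that opens the next block, so it ends just before position
      -- `x + e + 2`; the strict inequality `long` says that the phrase reaches that far.
      (+-cancelˡ-≤ p _ _ (≤-trans (≤-reflexive (begin
        p + length (X ++ win) ≡⟨ cong (p +_) (length-++ X) ⟩
        p + (length X + length win) ≡⟨ cong₂ (λ u v → p + (u + v)) |X| |win| ⟩
        p + (x ∸ p + (suc e + 1)) ≡⟨ +-assoc p (x ∸ p) _ ⟨
        p + (x ∸ p) + (suc e + 1) ≡⟨ cong (_+ (suc e + 1)) (m+[n∸m]≡n p≤) ⟩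
        x + (suc e + 1) ≡⟨ +-assoc x (suc e) 1 ⟨
        x + suc e + 1 ≡⟨ +-comm _ 1 ⟩
        suc (x + suc e) ∎)) long))

    cannot-copy : ∀ s → s ≡ source → ¬ x + suc e < p + List⁺.length f
    -- An explicit phrase has one letter and starts at or before `x`, hence it ends at or before
    -- `x + 1`.
    cannot-copy nothing refl long = <-irrefl refl (≤-trans long (≤-trans
      (≤-reflexive (cong (p +_) (explicit (before , after , ps≡ , refl))))
      (≤-trans (+-monoˡ-≤ 1 p≤) (+-monoʳ-≤ x (s≤s z≤n)))))
    cannot-copy (just q) refl long
      with Y , f≡ ← factor long
      with q≢p , eq ← copy (before , after , ps≡ , refl)
      -- The copy also reads `X` followed by `win`. As `win` starts only at `x`, both `q + length X`
      -- and `p + length X` equal `x`, which contradicts `q ≢ p`.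
      = q≢p (+-cancelʳ-≡ (length X) q p (begin
        q + length X ≡⟨ occurrence-unique b≢c pre e (q + length X) e∉pre e∉post (begin
          drop (q + length X) (runs b c (pre ++ e ∷ e′ ∷ post)) ≡⟨ cong (drop (q + length X)) w≡runs ⟨
          drop (q + length X) w ≡⟨ drop-drop q (length X) w ⟨
          drop (length X) (drop q w) ≡⟨ cong (drop (length X)) (take++drop≡id (List⁺.length f) (drop q w)) ⟨
          drop (length X) (take (List⁺.length f) (drop q w) ++ Z) ≡⟨ cong (λ z → drop (length X) (z ++ Z)) (trans eq f≡) ⟩
          drop (length X) (((X ++ win) ++ Y) ++ Z) ≡⟨ cong (drop (length X)) (trans (++-assoc (X ++ win) Y Z) (++-assoc X win (Y ++ Z))) ⟩
          drop (length X) (X ++ win ++ Y ++ Z) ≡⟨ drop-length-++ X ⟩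
          win ++ Y ++ Z ≡⟨ cong (b ∷_) (++-assoc (replicate e c) [ b ] (Y ++ Z)) ⟩
          b ∷ replicate e c ++ b ∷ Y ++ Z ∎) ⟩
        x ≡⟨ m+[n∸m]≡n p≤ ⟨
        p + (x ∸ p) ≡⟨ cong (p +_) |X| ⟨
        p + length X ∎))
      where Z = drop (List⁺.length f) (drop q w)

  -- No phrase contains the starts of two of the first m + 1 blocks.
  phrases-≥ : ∀ {m k ks} → All (m ≤_) (k ∷ ks) → (s : MacroScheme (runs b c (downFrom m ++ k ∷ ks))) →
              m < MacroScheme.size s
  phrases-≥ {M} {k} {ks} M≤ks s = go M [] [] phrases refl [] refl M≤ks z≤n
    where
    open MacroScheme s
    w = runs b c (downFrom M ++ k ∷ ks)

    -- Invariant: the phrases in `before` end no later than the blocks in `pre`. One step moves one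
    -- phrase and one block across and keeps this by `phrase-ends`.
    go : ∀ m pre before after → phrases ≡ before ++ after → All (m ≤_) pre →
         downFrom M ++ k ∷ ks ≡ pre ++ downFrom m ++ k ∷ ks → All (m ≤_) (k ∷ ks) →
         length (contents before) ≤ length (runs b c pre) → m < length after
    -- The block of `k` always remains after `pre`, so the phrases in `before` cannot cover all of
    -- `w`. This gives one phrase beyond the `m` counted by the induction.
    go m pre before [] ps≡ _ es≡ _ p≤ = ⊥-elim (<⇒≱ short p≤)
      where
      open ≤-Reasoning
      es = downFrom m ++ k ∷ ks
      short : length (runs b c pre) < length (contents before)
      short = begin-strict
        length (runs b c pre) <⟨ m<m+n _ (≤-trans (s≤s z≤n) (≤-trans (length-++-≤ʳ (k ∷ ks) {downFrom m}) (length-runs-≥ es))) ⟩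
        length (runs b c pre) + length (runs b c es) ≡⟨ length-++ (runs b c pre) ⟨
        length (runs b c pre ++ runs b c es) ≡⟨ cong length (concatMap-++ _ pre es) ⟨
        length (runs b c (pre ++ es)) ≡⟨ cong (length ∘ runs b c) es≡ ⟨
        length w ≡⟨ cong length factorization ⟨
        length (contents phrases) ≡⟨ cong (length ∘ contents) (trans ps≡ (++-identityʳ before)) ⟩
        length (contents before) ∎
    go zero pre before (f ∷ after) _ _ _ _ _ = s≤s z≤n
    go (suc e) pre before (f ∷ after) ps≡ e<pre es≡ e<ks p≤ =
      s≤s (go e (pre ++ [ e ]) (before ++ [ f ]) after
        (trans ps≡ (sym (++-assoc before [ f ] after)))
        (All.++⁺ (All.map <⇒≤ e<pre) (≤-refl ∷ []))
        (trans es≡ (sym (++-assoc pre [ e ] _)))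
        (All.map <⇒≤ e<ks)
        (≤-trans (≤-reflexive |before|) (≤-trans ends (≤-reflexive |pre|))))
      where
      -- The block after that of `e` has exponent `e - 1`, or `k` if `e` is 0; its `b` closes the
      -- factor considered in `phrase-ends`.
      post : ∀ m → ∃₂ λ k′ ks′ → downFrom m ++ k ∷ ks ≡ k′ ∷ ks′
      post zero    = k , ks , refl
      post (suc m) = m , downFrom m ++ k ∷ ks , refl
      e∉pre : e ∉ pre
      e∉pre e∈ = <-irrefl refl (All.lookup e<pre e∈)
      e∉post : e ∉ downFrom e ++ k ∷ ks
      e∉post e∈ with ∈-++⁻ (downFrom e) e∈
      ... | inj₁ e∈ = <-irrefl refl (∈-downFrom⁻ e∈)
      ... | inj₂ e∈ = <-irrefl refl (All.lookup e<ks e∈)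

      |before| : length (contents (before ++ [ f ])) ≡ length (contents before) + List⁺.length (proj₁ f)
      |before| = trans (cong length (concatMap-++ _ before [ f ]))
        (trans (length-++ (contents before)) (cong (λ z → length (contents before) + length z) (++-identityʳ (toList (proj₁ f)))))

      |pre| : length (runs b c pre) + suc e ≡ length (runs b c (pre ++ [ e ]))
      |pre| = sym (trans (cong length (concatMap-++ _ pre [ e ])) (trans (length-++ (runs b c pre))
        (cong (length (runs b c pre) +_) (cong suc (trans (cong length (++-identityʳ (replicate e c))) (length-replicate e))))))

      ends : length (contents before) + List⁺.length (proj₁ f) ≤ length (runs b c pre) + suc e
      ends with k′ , ks′ , post≡ ← post e
        = phrase-ends {pre = pre} {e} {k′} {ks′} {before} {f} {after} s (cong (runs b c) (trans es≡ (cong (λ z → pre ++ e ∷ z) post≡)))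
            e∉pre (subst (e ∉_) post≡ e∉post) ps≡ p≤

-- Extraction symbols over an ordinary morphism

-- The position after pre in concatMap f xs lies in the image of point.
record Located {A B : Set} (f : A → List B) (xs : List A) (pre : List B) (y : B) : Set where
  constructor located
  field
    {before after} : List A
    {point}        : A
    {left right}   : List B
    xs≡            : xs ≡ before ++ point ∷ after
    pre≡           : pre ≡ concatMap f before ++ left
    point≡         : f point ≡ left ++ y ∷ right

locate : ∀ {A B : Set} (f : A → List B) xs pre {y post} → concatMap f xs ≡ pre ++ y ∷ post → Located f xs pre y
locate {A} {B} f [] [] ()
locate {A} {B} f [] (_ ∷ _) ()
locate {A} {B} f (x ∷ xs) pre {y} {post} eq = go (f x) [] pre refl refl eq
  where
  -- `left` holds the letters of `f x` already passed; once `f x` is used up, the position lies in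
  -- the image of a later letter.
  go : ∀ ys left pre′ → f x ≡ left ++ ys → pre ≡ left ++ pre′ → ys ++ concatMap f xs ≡ pre′ ++ y ∷ post →
       Located f (x ∷ xs) pre y
  go [] left pre′ fx≡ refl eq with located refl refl point≡ ← locate f xs pre′ eq =
    located refl (trans (cong (_++ _) (sym (trans fx≡ (++-identityʳ left)))) (sym (++-assoc (f x) _ _))) point≡
  go (_ ∷ ys) left [] fx≡ refl eq with refl , _ ← ∷-injective eq =
    located {before = []} refl (++-identityʳ left) fx≡
  go (z ∷ ys) left (_ ∷ pre′) fx≡ pre≡ eq with refl , eq′ ← ∷-injective eq =
    go ys (left ++ [ z ]) pre′ (trans fx≡ (sym (++-assoc left [ z ] ys))) (trans pre≡ (sym (++-assoc left [ z ] pre′))) eq′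

lookup-++ : ∀ {A : Set} (pre : List A) x post →
            ∃[ o ] toℕ o ≡ length pre × lookup (pre ++ x ∷ post) o ≡ x
lookup-++ []        x post = zero , refl , refl
lookup-++ (y ∷ pre) x post with o , o≡ , x≡ ← lookup-++ pre x post = suc o , cong suc o≡ , x≡

length-snoc : ∀ {A : Set} (xs : List A) x → length (xs ++ [ x ]) ≡ suc (length xs)
length-snoc xs x = trans (length-++ xs) (+-comm _ 1)

iterated : ∀ {A : Set} → (A → List A) → List A → ℕ → List A
iterated φ u = fold u (concatMap φ)

-- A symbol `a(k)[1:j]` kept together with the string of length `j` that it is meant to denote; only
-- prefixes of levels are extracted.
Extraction : ℕ → Set
Extraction v = Fin v × ℕ × List (Fin v)

denoted : ∀ {v} → Extraction v → List (Fin v)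
denoted (_ , _ , ys) = ys

asItem : ∀ {v} → Extraction v → Item v
asItem (a , k , ys) = extract a k 1 (length ys)

module Cells {v} (R : Fin v → List⁺ (Item v)) (τ : Fin v → Fin v) where
  open Semantics R τ

  axiom-cell : ∀ {u} pre e post → u ≡ pre ++ e ∷ post → CellAt u 0 (length pre) (item e)
  axiom-cell {u} pre e post refl with o , o≡ , e≡ ← lookup-++ pre e post =
    subst₂ (λ q e → CellAt u 0 q (item e)) o≡ e≡ (start o)

  module _ (φ : Fin v → List (Fin v)) (R≡φ : ∀ a → toList (R a) ≡ map symbol (φ a)) (u : List (Fin v)) where

    -- A position is given by the prefix before it. A cell of level `k + 1` needs the offset of its
    -- parent in level `k`, and an offset needs all cells before it in the same level. `Reverse`
    -- splits off the last cell, as the constructors of offsets append at the end.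
    cell : ∀ k pre c {post} → iterated φ u k ≡ pre ++ c ∷ post → CellAt (map symbol u) k (length pre) (item (symbol c))
    offset : ∀ k {pre} → Reverse pre → ∀ {post} → iterated φ u k ≡ pre ++ post →
             NextOffset (map symbol u) k (length pre) (length (concatMap φ pre))

    offset k []              eq = none
    offset k (pre ∶ r ∶ʳ c) {post} eq =
      subst₂ (NextOffset (map symbol u) k) (sym (length-snoc pre c)) (sym |φ|)
        (rewritten (offset k r eq′) (cell k pre c eq′) ordinary)
      where
      open ≡-Reasoning
      eq′ : iterated φ u k ≡ pre ++ c ∷ post
      eq′ = trans eq (++-assoc pre [ c ] post)
      |φ| : length (concatMap φ (pre ++ [ c ])) ≡ length (concatMap φ pre) + List⁺.length (R c)
      |φ| = begin
        length (concatMap φ (pre ++ [ c ])) ≡⟨ cong length (concatMap-++ φ pre [ c ]) ⟩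
        length (concatMap φ pre ++ φ c ++ []) ≡⟨ length-++ (concatMap φ pre) ⟩
        length (concatMap φ pre) + length (φ c ++ []) ≡⟨ cong (λ z → length (concatMap φ pre) + length z) (++-identityʳ (φ c)) ⟩
        length (concatMap φ pre) + length (φ c) ≡⟨ cong (length (concatMap φ pre) +_) (length-map symbol (φ c)) ⟨
        length (concatMap φ pre) + length (map symbol (φ c)) ≡⟨ cong (λ z → length (concatMap φ pre) + length z) (R≡φ c) ⟨
        length (concatMap φ pre) + List⁺.length (R c) ∎

    cell zero pre c {post} eq =
      subst (λ q → CellAt (map symbol u) 0 q (item (symbol c))) (length-map symbol pre)
        (axiom-cell (map symbol pre) (symbol c) (map symbol post) (trans (cong (map symbol) eq) (map-++ symbol pre (c ∷ post))))
    cell (suc k) pre c eq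
      with located {before} {point = a} {left} {right} level≡ refl φa≡ ← locate φ (iterated φ u k) pre eq
      with lookup-++ (map symbol left) (symbol c) (map symbol right) | trans (R≡φ a) (trans (cong (map symbol) φa≡) (map-++ symbol left (c ∷ right)))
    ... | found | Ra≡
      with o , o≡ , c≡ ← subst (λ r → ∃[ o ] toℕ o ≡ length (map symbol left) × lookup r o ≡ symbol c) (sym Ra≡) found
      = subst₂ (CellAt (map symbol u) (suc k))
          (trans (cong (length (concatMap φ before) +_) (trans o≡ (length-map symbol left))) (sym (length-++ (concatMap φ before))))
          (cong item c≡)
          (rewritten (offset k (reverseView before) level≡) (cell k before a level≡) ordinary o)

    final : ∀ k {pre} → Reverse pre → ∀ {post} → iterated φ u k ≡ pre ++ post →
            FinalOffset (map symbol u) k (length pre) (length pre)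
    final k []              eq = none
    final k (pre ∶ r ∶ʳ c) {post} eq =
      subst₂ (FinalOffset (map symbol u) k) (sym (length-snoc pre c)) (trans (+-comm _ 1) (sym (length-snoc pre c)))
        (more (final k r eq′) (cell k pre c eq′))
      where
      eq′ : iterated φ u k ≡ pre ++ c ∷ post
      eq′ = trans eq (++-assoc pre [ c ] post)

    symbolAt : ∀ k pre c {post} → iterated φ u k ≡ pre ++ c ∷ post → SymbolAt (map symbol u) k (suc (length pre)) c
    symbolAt k pre c eq = kept (final k (reverseView pre) eq) (cell k pre c eq) ordinary

  module _ (φ : Fin v → List (Fin v)) (R≡φ : ∀ a → toList (R a) ≡ map symbol (φ a)) where

    Valid : Extraction v → Set
    Valid (a , k , ys) = ∃[ zs ] iterated φ [ a ] k ≡ ys ++ zs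

    symbolAt-denoted : ∀ {a k ys} → Valid (a , k , ys) → ∀ pre {c post} → ys ≡ pre ++ c ∷ post →
                       SymbolAt (symbol a ∷ []) k (suc (length pre)) c
    symbolAt-denoted {a} {k} (zs , level≡) pre {c} {post} ys≡ =
      symbolAt φ R≡φ [ a ] k pre c (trans level≡ (trans (cong (_++ zs) ys≡) (++-assoc pre (c ∷ post) zs)))

    final-extracts : ∀ {es pre} → Reverse pre → ∀ {post} → es ≡ pre ++ post →
            FinalOffset (map asItem es) 0 (length pre) (length (concatMap denoted pre))
    final-extracts []             eq = none
    final-extracts {es} (pre ∶ r ∶ʳ e) {post} eq =
      subst₂ (FinalOffset (map asItem es) 0) (sym (length-snoc pre e))
        (sym (trans (cong length (concatMap-++ denoted pre [ e ]))
          (trans (length-++ (concatMap denoted pre)) (cong (λ z → length (concatMap denoted pre) + length z) (++-identityʳ (denoted e))))))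
        (more (final-extracts r eq′)
          (subst (λ q → CellAt (map asItem es) 0 q (item (asItem e))) (length-map asItem pre)
            (axiom-cell (map asItem pre) (asItem e) (map asItem post) (trans (cong (map asItem) eq′) (map-++ asItem pre (e ∷ post))))))
      where
      eq′ : es ≡ pre ++ e ∷ post
      eq′ = trans eq (++-assoc pre [ e ] post)

    -- The axiom is read at level 0, so each extraction symbol is replaced directly; the `τ` is the
    -- coding that the extraction itself applies.
    symbolAt-extracts : ∀ {es} → All Valid es → ∀ pre {c post} → concatMap denoted es ≡ pre ++ c ∷ post →
                        SymbolAt (map asItem es) 0 (suc (length pre)) (τ c)
    symbolAt-extracts {es} valid pre {c} eq
      with located {before} {after} {e} {left} {right} refl refl ys≡ ← locate denoted es pre eq
      = subst (λ p → SymbolAt (map asItem es) 0 (suc p) (τ c)) (sym (length-++ (concatMap denoted before)))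
          (replaced (final-extracts (reverseView before) refl)
            (subst (λ q → CellAt (map asItem es) 0 q (item (asItem e))) (length-map asItem before)
              (axiom-cell (map asItem before) (asItem e) (map asItem after) (map-++ asItem before (e ∷ after))))
            (subst (length left <_) (sym (trans (cong length ys≡) (length-++ left))) (m<m+n _ (s≤s z≤n)))
            (extracted (symbolAt-denoted (All.lookup valid (∈-++⁺ʳ before (here refl))) left ys≡)))

-- Iterating the morphism a → ba, b → bc, c → c.

iterated-suc : ∀ {A : Set} (φ : A → List A) u k → iterated φ u (suc k) ≡ iterated φ (concatMap φ u) k
iterated-suc φ u k = trans (cong (iterated φ u) (+-comm 1 k)) (fold-+ u (concatMap φ) k)

iterated-++ : ∀ {A : Set} (φ : A → List A) u u′ k → iterated φ (u ++ u′) k ≡ iterated φ u k ++ iterated φ u′ k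
iterated-++ φ u u′ zero    = refl
iterated-++ φ u u′ (suc k) = trans (cong (concatMap φ) (iterated-++ φ u u′ k)) (concatMap-++ φ (iterated φ u k) (iterated φ u′ k))

-- `0F`, `1F` and `2F` play the roles of a, b and c.
φ₃ : Fin 3 → List⁺ (Fin 3)
φ₃ 0F = 1F ∷ 0F ∷ []
φ₃ 1F = 1F ∷ 2F ∷ []
φ₃ 2F = 2F ∷ []

run-level : ∀ k → iterated (toList ∘ φ₃) [ 1F ] k ≡ 1F ∷ replicate k 2F
run-level zero    = refl
run-level (suc k) = trans (cong (concatMap (toList ∘ φ₃)) (run-level k)) (cong (λ z → 1F ∷ 2F ∷ z) (fixed k))
  where
  fixed : ∀ k → concatMap (toList ∘ φ₃) (replicate k 2F) ≡ replicate k 2F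
  fixed zero    = refl
  fixed (suc k) = cong (2F ∷_) (fixed k)

-- Unfolding the first application, level `k + 1` of a is level `k` of b followed by level `k` of a,
-- so the longest block comes first.
runs-level : ∀ k → iterated (toList ∘ φ₃) [ 0F ] k ≡ runs 1F 2F (downFrom k) ++ [ 0F ]
runs-level zero    = refl
runs-level (suc k) = begin
  iterated φ [ 0F ] (suc k)                                   ≡⟨ iterated-suc φ [ 0F ] k ⟩
  iterated φ (1F ∷ 0F ∷ []) k                                 ≡⟨ iterated-++ φ [ 1F ] [ 0F ] k ⟩
  iterated φ [ 1F ] k ++ iterated φ [ 0F ] k                  ≡⟨ cong₂ _++_ (run-level k) (runs-level k) ⟩
  (1F ∷ replicate k 2F) ++ runs 1F 2F (downFrom k) ++ [ 0F ]  ≡⟨ ++-assoc (1F ∷ replicate k 2F) _ _ ⟨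
  runs 1F 2F (downFrom (suc k)) ++ [ 0F ]                     ∎
  where
  open ≡-Reasoning
  φ = toList ∘ φ₃

-- The small NU-system.

rules : Fin 3 → List⁺ (Item 3)
rules = List⁺.map symbol ∘ φ₃

lookup-map-∃ : ∀ {A B : Set} (f : A → B) xs (x : Fin (length (map f xs))) →
               ∃[ pre ] ∃[ y ] ∃[ post ] xs ≡ pre ++ y ∷ post × toℕ x ≡ length pre × lookup (map f xs) x ≡ f y
lookup-map-∃ f (y ∷ ys) zero    = [] , y , ys , refl , refl , refl
lookup-map-∃ f (y ∷ ys) (suc x) with pre , z , post , refl , x≡ , eq ← lookup-map-∃ f ys x =
  y ∷ pre , z , post , refl , cong suc x≡ , eq

length-concatMap-∈ : ∀ {A B : Set} (f : A → List B) {x xs} → x ∈ xs → length (f x) ≤ length (concatMap f xs)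
length-concatMap-∈ f {xs = x ∷ xs} (here refl) = length-++-≤ˡ (f x)
length-concatMap-∈ f {xs = y ∷ xs} (there x∈) = ≤-trans (length-concatMap-∈ f x∈) (length-++-≤ʳ _ {f y})

factor-at : ∀ {A : Set} (ys : List A) {x} → x < length ys →
            ∃[ pre ] ∃[ y ] ∃[ post ] ys ≡ pre ++ y ∷ post × length pre ≡ x
factor-at (y ∷ ys) {zero}  _ = [] , y , ys , refl , refl
factor-at (y ∷ ys) {suc x} (s≤s x<) with pre , z , post , refl , refl ← factor-at ys x< =
  y ∷ pre , z , post , refl , refl

module RunSystem (m : ℕ) (0<m : 0 < m) (ks : List ℕ) where

  open Cells rules id

  R≡φ : ∀ a → toList (rules a) ≡ map symbol (toList (φ₃ a))
  R≡φ _ = refl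

  φ = toList ∘ φ₃

  -- A single extraction yields all `m` decreasing blocks, and each further block costs one more.
  -- `0 < m` makes the first string non-empty, as intervals must be.
  extractions : List (Extraction 3)
  extractions = (0F , m , runs 1F 2F (downFrom m)) ∷ map (λ k → 1F , k , 1F ∷ replicate k 2F) ks

  word₃ : List (Fin 3)
  word₃ = concatMap denoted extractions

  word₃≡ : word₃ ≡ runs 1F 2F (downFrom m ++ ks)
  word₃≡ = trans (cong (runs 1F 2F (downFrom m) ++_) (concatMap-map _ _ ks)) (sym (concatMap-++ _ (downFrom m) ks))

  map-word₃ : map toℕ word₃ ≡ runs 1 2 (downFrom m ++ ks)
  map-word₃ = trans (cong (map toℕ) word₃≡) (map-runs toℕ 1F 2F (downFrom m ++ ks))

  valid : All (Valid φ R≡φ) extractions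
  valid = ([ 0F ] , runs-level m) ∷ All.map⁺ (All.universal (λ k → [] , trans (run-level k) (sym (++-identityʳ _))) ks)

  -- Supplies the bounds on indexes: a level is at most the length of its extracted string, hence at
  -- most the length of the whole word.
  level-≤ : All (λ (a , k , ys) → k ≤ length ys × 1 ≤ length ys) extractions
  level-≤ = (m≤ , ≤-trans 0<m m≤) ∷ All.map⁺ (All.universal (λ k → m≤n⇒m≤1+n (≤-reflexive (sym (length-replicate k))) , s≤s z≤n) ks)
    where
    m≤ : m ≤ length (runs 1F 2F (downFrom m))
    m≤ = ≤-trans (≤-reflexive (sym (length-downFrom m))) (length-runs-≥ (downFrom m))

  items : List⁺ (Item 3)
  items = asItem (0F , m , runs 1F 2F (downFrom m)) ∷ map (asItem) (map (λ k → 1F , k , 1F ∷ replicate k 2F) ks)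

  occurring : ∀ {a k i j} → extract a k i j ∈ toList items →
              ∃[ ys ] (a , k , ys) ∈ extractions × i ≡ 1 × j ≡ length ys
  occurring e∈ with (_ , _ , ys) , ∈es , refl ← ∈-map⁻ (asItem) {xs = extractions} e∈ = ys , ∈es , refl , refl

  system : NUSystem
  system = record
    { v = 3
    ; name = toℕ
    ; name-injective = toℕ-injective
    ; R = rules
    ; τ = id
    ; axiom = items
    ; d = 0
    ; n = length word₃
    ; n≥1 = ≤-trans (proj₂ (All.head level-≤)) (length-concatMap-∈ denoted {xs = extractions} (here refl))
    ; d≤n = z≤n
    ; indexes = λ where
        (inj₁ e∈) → indexes e∈
        (inj₂ (a , e∈)) → ⊥-elim (ordinary-rules a e∈)
    ; loopFree = λ where
        (inj₁ e∈) x 1≤x x≤j → loopFree e∈ x 1≤x x≤j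
        (inj₂ (a , e∈)) → ⊥-elim (ordinary-rules a e∈)
    }
    where
    ordinary-rules : ∀ a′ {a k i j} → extract a k i j ∉ toList (rules a′)
    ordinary-rules a′ e∈ with ∈-map⁻ symbol {xs = φ a′} e∈
    ... | ()
    indexes : ∀ {a k i j} → extract a k i j ∈ toList items → k ≤ length word₃ × 1 ≤ i × i ≤ j × j ≤ length word₃
    indexes e∈ with ys , ∈es , refl , refl ← occurring e∈
      with k≤ , 1≤ ← All.lookup level-≤ ∈es
      = ≤-trans k≤ (length-concatMap-∈ denoted ∈es) , ≤-refl , 1≤ , length-concatMap-∈ denoted ∈es
    loopFree : ∀ {a k i j} → extract a k i j ∈ toList items →
               ∀ x → i ≤ x → x ≤ j → ∃[ c ] Semantics.SymbolAt rules id (symbol a ∷ []) k x c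
    loopFree e∈ x 1≤x x≤j with ys , ∈es , refl , refl ← occurring e∈
      with x | 1≤x
    ... | suc x | s≤s _ with pre , c , post , ys≡ , refl ← factor-at ys x≤j
      = c , symbolAt-denoted φ R≡φ (All.lookup valid ∈es) pre ys≡

  generates-runs : NUSystem.Generates system (runs 1 2 (downFrom m ++ ks))
  generates-runs = subst (NUSystem.Generates system) map-word₃ (length-map toℕ word₃ , symbols)
    where
    symbols : (x : Fin (length (map toℕ word₃))) →
              ∃[ c ] NUSystem.SymbolAt system (toList items) 0 (suc (toℕ x)) c × lookup (map toℕ word₃) x ≡ toℕ c
    symbols x with pre , c , post , w≡ , x≡ , eq ← lookup-map-∃ toℕ word₃ x =
      c , subst (λ p → NUSystem.SymbolAt system (toList items) 0 (suc p) c) (sym x≡)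
            (symbolAt-extracts φ R≡φ valid pre w≡) , eq

  -- The 14 consists of 5 for the rules, 4 for the first extraction, 3 for the alphabet and the
  -- constant 2. The value is independent of `m`, so `m` may be taken far larger.
  size≡ : NUSystem.size system ≡ length ks * 4 + 14
  size≡ = begin
    9 + extracts ks + 3 + 2  ≡⟨ +-assoc (9 + extracts ks) 3 2 ⟩
    9 + (extracts ks + 5)    ≡⟨ +-comm 9 _ ⟩
    extracts ks + 5 + 9      ≡⟨ +-assoc (extracts ks) 5 9 ⟩
    extracts ks + 14         ≡⟨ cong (_+ 14) (extracts≡ ks) ⟩
    length ks * 4 + 14       ∎
    where
    open ≡-Reasoning
    extracts : List ℕ → ℕ
    extracts ks = sum (map itemSize (map asItem (map (λ k → 1F , k , 1F ∷ replicate k 2F) ks)))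
    extracts≡ : ∀ ks → extracts ks ≡ length ks * 4
    extracts≡ []       = refl
    extracts≡ (_ ∷ ks) = cong (4 +_) (extracts≡ ks)

-- Enumerating L-systems of bounded size

letters : List ℕ
letters = 1 ∷ 2 ∷ []

boundedLists : {A : Set} → List A → ℕ → List (List A)
boundedLists xs zero    = [ [] ]
boundedLists xs (suc m) = [] ∷ cartesianProductWith _∷_ xs (boundedLists xs m)

∈-boundedLists : ∀ {A : Set} {xs : List A} {ys m} → All (_∈ xs) ys → length ys ≤ m → ys ∈ boundedLists xs m
∈-boundedLists {m = zero}  []         _        = here refl
∈-boundedLists {m = suc m} []         _        = here refl
∈-boundedLists {m = suc m} (y∈ ∷ ys∈) (s≤s le) = there (∈-cartesianProductWith⁺ _∷_ y∈ (∈-boundedLists ys∈ le))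

vectors : {A : Set} → List A → ∀ n → List (Vec A n)
vectors xs zero    = [ [] ]
vectors xs (suc n) = cartesianProductWith _∷_ xs (vectors xs n)

tabulate∈vectors : ∀ {A : Set} {xs : List A} {n} (f : Fin n → A) → (∀ i → f i ∈ xs) → Vec.tabulate f ∈ vectors xs n
tabulate∈vectors {n = zero}  f f∈ = here refl
tabulate∈vectors {n = suc n} f f∈ = ∈-cartesianProductWith⁺ _∷_ (f∈ zero) (tabulate∈vectors (f ∘ suc) (f∈ ∘ suc))

length-cartesianProductWith : ∀ {A B C : Set} (f : A → B → C) xs ys →
                              length (cartesianProductWith f xs ys) ≡ length xs * length ys
length-cartesianProductWith f []       ys = refl
length-cartesianProductWith f (x ∷ xs) ys = trans (length-++ (map (f x) ys))
  (cong₂ _+_ (length-map (f x) ys) (length-cartesianProductWith f xs ys))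

≤-sum : ∀ {x xs} → x ∈ xs → x ≤ sum xs
≤-sum {x} {_ ∷ xs} (here refl) = m≤m+n x (sum xs)
≤-sum {xs = y ∷ _} (there x∈)  = ≤-trans (≤-sum x∈) (m≤n+m _ y)

-- An L-system without its level and prefix length; the vector of letters merges name and τ.
Code : Set
Code = Σ[ σ ∈ ℕ ] Vec (List (Fin σ)) σ × Vec ℕ σ × List (Fin σ)

generate : Code → ℕ × ℕ → Word
generate (_ , rules , coding , axiom) (d , n) =
  map (Vec.lookup coding) (take n (iterated (Vec.lookup rules) axiom d))

codesOver : ℕ → ℕ → List Code
codesOver m σ = map (σ ,_)
  (cartesianProduct (vectors (boundedLists (allFin σ) m) σ)
    (cartesianProduct (vectors letters σ) (boundedLists (allFin σ) m)))

-- An overcount: alphabet, right-hand sides and axiom are each bounded by `m` separately. What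
-- matters is that the number of codes depends on `m` alone.
codes : ℕ → List Code
codes m = concatMap (codesOver m) (upTo (suc m))

-- Symbols that do not occur in the generated word may have any name: clamping all names to the
-- letters leaves the word unchanged and only finitely many codes.
clamp : ℕ → ℕ
clamp 1 = 1
clamp _ = 2

clamp∈ : ∀ x → clamp x ∈ letters
clamp∈ 0             = there (here refl)
clamp∈ 1             = here refl
clamp∈ (suc (suc _)) = there (here refl)

module _ (L : LSystem) where
  open LSystem L

  code : Code
  code = σ , Vec.tabulate (toList ∘ φ) , Vec.tabulate (clamp ∘ name ∘ τ) , toList axiom

  level-code : ∀ k → iterated (Vec.lookup (Vec.tabulate (toList ∘ φ))) (toList axiom) k ≡ level k
  level-code zero    = refl
  level-code (suc k) = trans (cong (concatMap _) (level-code k))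
    (concatMap-cong (Vec.lookup∘tabulate (toList ∘ φ)) (level k))

  generate-code : ∀ {w} → Generates w → generate code (d , n) ≡ map clamp w
  generate-code (_ , refl) = begin
    map (Vec.lookup (Vec.tabulate (clamp ∘ name ∘ τ))) (take n (iterated _ _ d)) ≡⟨ cong (map (Vec.lookup (Vec.tabulate (clamp ∘ name ∘ τ))) ∘ take n) (level-code d) ⟩
    map (Vec.lookup (Vec.tabulate (clamp ∘ name ∘ τ))) (take n (level d)) ≡⟨ map-cong (Vec.lookup∘tabulate (clamp ∘ name ∘ τ)) (take n (level d)) ⟩
    map (clamp ∘ name ∘ τ) (take n (level d)) ≡⟨ map-∘ (take n (level d)) ⟩
    map clamp (map (name ∘ τ) (take n (level d))) ∎
    where open ≡-Reasoning

  code∈codes : ∀ {m} → size ≤ m → code ∈ codes m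
  code∈codes {m} size≤m = ∈-concatMap⁺ (codesOver m) (lose (∈-upTo⁺ (s≤s σ≤m)) (∈-map⁺ (σ ,_)
    (∈-cartesianProduct⁺ (tabulate∈vectors (toList ∘ φ) λ a → ∈-boundedLists (All.universal ∈-allFin _) (φ≤m a))
      (∈-cartesianProduct⁺ (tabulate∈vectors (clamp ∘ name ∘ τ) (clamp∈ ∘ name ∘ τ))
        (∈-boundedLists (All.universal ∈-allFin _) axiom≤m)))))
    where
    Σφ = sum (map (List⁺.length ∘ φ) (allFin σ))
    Σφ+axiom+σ≤m : Σφ + List⁺.length axiom + σ ≤ m
    Σφ+axiom+σ≤m = m+n≤o⇒m≤o _ size≤m
    Σφ+axiom≤m : Σφ + List⁺.length axiom ≤ m
    Σφ+axiom≤m = m+n≤o⇒m≤o _ Σφ+axiom+σ≤m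
    σ≤m : σ ≤ m
    σ≤m = m+n≤o⇒n≤o (Σφ + List⁺.length axiom) Σφ+axiom+σ≤m
    axiom≤m : List⁺.length axiom ≤ m
    axiom≤m = m+n≤o⇒n≤o Σφ Σφ+axiom≤m
    φ≤m : ∀ a → List⁺.length (φ a) ≤ m
    φ≤m a = ≤-trans (≤-sum (∈-map⁺ (List⁺.length ∘ φ) (∈-allFin a))) (m+n≤o⇒m≤o Σφ Σφ+axiom≤m)

clamp-runs : ∀ es → map clamp (runs 1 2 es) ≡ runs 1 2 es
clamp-runs = map-runs clamp 1 2

-- Counting the words of small L-systems.

generable : (m d n : ℕ) → List Word
generable m d n = cartesianProductWith generate (codes m) (cartesianProduct (upTo (suc d)) (upTo (suc n)))

length-generable : ∀ m d n → length (generable m d n) ≡ length (codes m) * (suc d * suc n)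
length-generable m d n = trans (length-cartesianProductWith generate (codes m) _)
  (cong (length (codes m) *_) (trans (length-cartesianProductWith _,_ (upTo (suc d)) (upTo (suc n)))
    (cong₂ _*_ (length-upTo (suc d)) (length-upTo (suc n)))))

-- Clamping fixes words over 1 and 2, so the code of `L` generates the very same word.
∈-generable : ∀ {m D N} es (L : LSystem) → LSystem.Generates L (runs 1 2 es) → LSystem.size L ≤ m →
              LSystem.d L ≤ D → LSystem.n L ≤ N → runs 1 2 es ∈ generable m D N
∈-generable {m} {D} {N} es L gen size≤ d≤ n≤ =
  subst (_∈ generable m D N) (trans (generate-code L gen) (clamp-runs es))
    (∈-cartesianProductWith⁺ generate (code∈codes L size≤) (∈-cartesianProduct⁺ (∈-upTo⁺ (s≤s d≤)) (∈-upTo⁺ (s≤s n≤))))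

-- If all values of `f` lay in `ws`, two of them would share an index in `ws` by the pigeonhole
-- principle and so be equal.
escape : ∀ {A : Set} (_≟_ : (x y : A) → Dec (x ≡ y)) {n} (f : Fin n → A) → (∀ i j → f i ≡ f j → i ≡ j) →
         ∀ ws → length ws < n → ∃[ i ] f i ∉ ws
escape _≟_ {n} f injective ws ws<n with any? (λ i → ¬? (DecMembership._∈?_ _≟_ (f i) ws))
... | yes found = found
... | no  none  = ⊥-elim (<-irrefl (cong toℕ (injective i j (Membership.index-injective (setoid _) (f∈ i) (f∈ j) fi≡fj))) i<j)
  where
  open DecMembership _≟_ using (_∈?_)
  f∈ : ∀ i → f i ∈ ws
  f∈ i = decidable-stable (f i ∈? ws) (λ ∉ → none (i , ∉))
  collision = pigeonhole ws<n (Any.index ∘ f∈)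
  i = proj₁ collision
  j = proj₁ (proj₂ collision)
  i<j = proj₁ (proj₂ (proj₂ collision))
  fi≡fj = proj₂ (proj₂ (proj₂ collision))

tabulate-injective : ∀ {A : Set} {n} {f g : Fin n → A} → tabulate f ≡ tabulate g → f ≗ g
tabulate-injective eq zero    = ∷-injectiveˡ eq
tabulate-injective eq (suc i) = tabulate-injective (∷-injectiveʳ eq) i

funToFin-cong : ∀ {m n} {f g : Fin m → Fin n} → f ≗ g → funToFin f ≡ funToFin g
funToFin-cong {zero}  f≗g = refl
funToFin-cong {suc m} f≗g = cong₂ combine (f≗g zero) (funToFin-cong (f≗g ∘ suc))

finToFun-injective : ∀ {m n} {i j : Fin (m ^ n)} → finToFun {m} {n} i ≗ finToFun j → i ≡ j
finToFun-injective {m} {n} {i} {j} eq =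
  trans (sym (funToFin-finToFin {n} {m} i)) (trans (funToFin-cong eq) (funToFin-finToFin {n} {m} j))

suc-*-≤ : ∀ a {x N} → 1 ≤ x → a < N → suc (a * x) ≤ N * x
suc-*-≤ a {x} 1≤x a<N = ≤-trans (+-monoˡ-≤ (a * x) 1≤x) (*-monoˡ-≤ x a<N)

-- The exponent adds up 1 for the codes, `1 + 3T` for the levels and 4 for the prefix lengths; `N`
-- exceeds every constant factor, so each is absorbed by one more power.
few-generable : ∀ m T N → length (codes m) < N → T < N → 1 < N →
                length (generable m (T * (N ^ 3) ^ T) (N ^ 3)) < N ^ suc (suc (3 * T) + 4)
few-generable m T N f<N T<N 1<N = begin-strict
  length (generable m (T * (N ^ 3) ^ T) (N ^ 3)) ≡⟨ length-generable m (T * (N ^ 3) ^ T) (N ^ 3) ⟩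
  f * (suc (T * (N ^ 3) ^ T) * suc (N ^ 3))      ≡⟨ cong (λ z → f * (suc (T * z) * suc (N ^ 3))) (^-*-assoc N 3 T) ⟩
  f * (suc (T * N ^ (3 * T)) * suc (N ^ 3))      ≤⟨ *-monoʳ-≤ f (*-mono-≤ (suc-*-≤ T (m^n>0 N (3 * T)) T<N)
                                                      (subst (λ z → suc z ≤ N ^ 4) (*-identityˡ (N ^ 3)) (suc-*-≤ 1 (m^n>0 N 3) 1<N))) ⟩
  f * (N ^ suc (3 * T) * N ^ 4)                  ≡⟨ cong (f *_) (^-distribˡ-+-* N (suc (3 * T)) 4) ⟨
  f * N ^ (suc (3 * T) + 4)                      <⟨ *-monoˡ-< (N ^ (suc (3 * T) + 4)) {{m^n≢0 N (suc (3 * T) + 4)}} f<N ⟩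
  N ^ suc (suc (3 * T) + 4)                      ∎
  where
  open ≤-Reasoning
  f = length (codes m)
  instance
    N≢0 : NonZero N
    N≢0 = >-nonZero (≤-trans (s≤s z≤n) 1<N)

-- The separating family.

Separates : ℕ → Word → Set
Separates T w = ∀ {K c} → K ≤ T → c ≤ T → ∀ x y → ν w x → minᴹ (ℓ K) b w y → c * x ≤ y

-- `T` bounds both the polynomial constant `K` and the factor `c`, so that one sequence of words
-- serves all pairs of them.
separated-word : ∀ T → ∃[ w ] T ≤ length w × Separates T w
separated-word T = w , T≤|w| , separates
  where
  -- The order of choice avoids circularity: `t` depends on `T` only and matches `few-generable`,
  -- `s` is the size of the NU-system, `m` exceeds `T * s`, and `N` comes last because the number of
  -- codes depends on `m`.
  t = suc (suc (3 * T) + 4)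
  s = t * 4 + 14
  m = suc (T * s)
  f = length (codes m)
  N = m + t + (f + T + 2)

  f+T+2≤N : f + T + 2 ≤ N
  f+T+2≤N = m≤n+m _ (m + t)
  f<N : f < N
  f<N = ≤-trans (≤-trans (m<m+n f (s≤s z≤n)) (+-monoˡ-≤ 2 (m≤m+n f T))) f+T+2≤N
  T<N : T < N
  T<N = ≤-trans (≤-trans (m<m+n T (s≤s z≤n)) (+-monoˡ-≤ 2 (m≤n+m T f))) f+T+2≤N
  1<N : 1 < N
  1<N = ≤-trans (m≤n+m 2 (f + T)) f+T+2≤N

  -- `i` encodes `t` digits below `N`. Adding `m` keeps these exponents away from the first `m`,
  -- each of which therefore stays unique.
  exponent : Fin (N ^ t) → Fin t → ℕ
  exponent i j = m + toℕ (finToFun {N} {t} i j)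
  ks : Fin (N ^ t) → List ℕ
  ks i = tabulate (exponent i)
  es : Fin (N ^ t) → List ℕ
  es i = downFrom m ++ ks i

  es-injective : ∀ i j → runs 1 2 (es i) ≡ runs 1 2 (es j) → i ≡ j
  es-injective i j eq = finToFun-injective {N} {t} λ l → toℕ-injective (+-cancelˡ-≡ m _ _
    (tabulate-injective {f = exponent i} {exponent j}
      (++-cancelˡ (downFrom m) (ks i) (ks j) (runs-injective (λ ()) (es i) (es j) eq)) l))

  choice : ∃[ i ] runs 1 2 (es i) ∉ generable m (T * (N ^ 3) ^ T) (N ^ 3)
  choice = escape (≡-dec _≟_) (runs 1 2 ∘ es) es-injective _ (few-generable m T N f<N T<N 1<N)

  i = proj₁ choice
  w = runs 1 2 (es i)

  |es| : length (es i) ≡ m + t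
  |es| = trans (length-++ (downFrom m)) (cong₂ _+_ (length-downFrom m) (length-tabulate (exponent i)))

  T≤|w| : T ≤ length w
  T≤|w| = begin
    T             ≤⟨ m≤n*m T 3 ⟩
    3 * T         ≤⟨ m≤n+m (3 * T) 2 ⟩
    2 + 3 * T     ≤⟨ m≤m+n (2 + 3 * T) 4 ⟩
    t             ≤⟨ m≤n+m t m ⟩
    m + t         ≡⟨ |es| ⟨
    length (es i) ≤⟨ length-runs-≥ (es i) ⟩
    length w      ∎
    where open ≤-Reasoning

  es<m+N : All (_< m + N) (es i)
  es<m+N = All.++⁺ (All.tabulate (λ e∈ → ≤-trans (∈-downFrom⁻ e∈) (m≤m+n m N)))
                   (All.tabulate⁺ {f = exponent i} (λ j → +-monoʳ-< m (toℕ<n (finToFun {N} {t} i j))))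

  -- There are `m + t ≤ N` blocks, each of length at most `m + N ≤ 2N ≤ N * N`.
  |w|≤ : length w ≤ N ^ 3
  |w|≤ = begin
    length w                ≤⟨ length-runs-≤ (es i) es<m+N ⟩
    length (es i) * (m + N) ≡⟨ cong (_* (m + N)) |es| ⟩
    (m + t) * (m + N)       ≤⟨ *-mono-≤ (m≤m+n (m + t) _) (+-monoˡ-≤ N (≤-trans (m≤m+n m t) (m≤m+n (m + t) _))) ⟩
    N * (N + N)             ≡⟨ cong (λ z → N * (N + z)) (+-identityʳ N) ⟨
    N * (2 * N)             ≤⟨ *-monoʳ-≤ N (*-monoˡ-≤ N 1<N) ⟩
    N * (N * N)             ≡⟨ cong (λ z → N * (N * z)) (*-identityʳ N) ⟨
    N ^ 3                   ∎
    where open ≤-Reasoning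

  ℓ-large : ∀ {K} → K ≤ T → ∀ L → LSystem.PolyBounded L K → LSystem.Generates L w → m ≤ LSystem.size L
  ℓ-large {K} K≤T L (d≤ , _) generates@(n≤level , eq) = ≮⇒≥ λ size<m →
    -- Since `n` is the length of `w`, the level satisfies `d ≤ K * n ^ K ≤ T * (N ^ 3) ^ T`, so a
    -- smaller system would put `w` among the words it was chosen to avoid.
    proj₂ choice (∈-generable (es i) L generates (<⇒≤ size<m) (≤-trans d≤ (*-mono-≤ K≤T
      (≤-trans (^-monoʳ-≤ n {{>-nonZero n≥1}} K≤T) (^-monoˡ-≤ T n≤)))) n≤)
    where
    open LSystem L using (n; n≥1; d; level; name; τ)
    open ≡-Reasoning
    n≡ : n ≡ length w
    n≡ = begin
      n                                       ≡⟨ m≤n⇒m⊓n≡m n≤level ⟨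
      n ⊓ length (level d)                    ≡⟨ length-take n (level d) ⟨
      length (take n (level d))               ≡⟨ length-map (name ∘ τ) (take n (level d)) ⟨
      length (map (name ∘ τ) (take n (level d))) ≡⟨ cong length eq ⟩
      length w                                ∎
    n≤ : n ≤ N ^ 3
    n≤ = ≤-trans (≤-reflexive n≡) |w|≤

  b-large : ∀ (S : MacroScheme w) → m ≤ MacroScheme.size S
  b-large S = <⇒≤ (phrases-≥ (λ ()) (All.tabulate⁺ {f = exponent i} (λ j → m≤m+n m (toℕ (finToFun {N} {t} i j)))) S)

  separates : Separates T w
  -- Minimality bounds `x` by the size of the NU-system, while `y` is the smaller of the sizes of
  -- the optimal `L` and `S`.
  separates {c = c} K≤T c≤T x y (_ , x-minimal)
    (_ , _ , ((L , (poly , generates) , refl) , _) , ((S , _ , refl) , _) , refl) = begin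
    c * x  ≤⟨ *-mono-≤ c≤T x≤s ⟩
    T * s  ≤⟨ n≤1+n _ ⟩
    m      ≤⟨ ⊓-glb (ℓ-large K≤T L poly generates) (b-large S) ⟩
    LSystem.size L ⊓ MacroScheme.size S ∎
    where
    open ≤-Reasoning
    open RunSystem m (s≤s z≤n) (ks i)
    x≤s : x ≤ s
    x≤s = begin
      x                                             ≤⟨ x-minimal system generates-runs ⟩
      NUSystem.size system ≡⟨ size≡ ⟩
      length (ks i) * 4 + 14                        ≡⟨ cong (λ l → l * 4 + 14) (length-tabulate (exponent i)) ⟩
      s                                             ∎

theorem2 : ∃[ F ] IsStringFamily F × (∀ K → LittleO F ν (minᴹ (ℓ K) b))
theorem2 = F , (λ m → word m , (m , refl) , proj₁ (proj₂ (separated-word m))) , λ K c → suc (bound (K + c)) , separation K c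
  where
  word : ℕ → Word
  word T = proj₁ (separated-word T)

  F : Word → Set
  F w = ∃[ T ] w ≡ word T

  -- A word longer than `bound (K + c)` differs from every `word T` with `T < K + c`, so its index
  -- is at least both `K` and `c`.
  bound : ℕ → ℕ
  bound T = sum (map (length ∘ word) (upTo T))

  separation : ∀ K c w → F w → suc (bound (K + c)) ≤ length w → ∀ x y → ν w x → minᴹ (ℓ K) b w y → c * x ≤ y
  separation K c w (T , refl) long = proj₂ (proj₂ (separated-word T))
    (m+n≤o⇒m≤o K K+c≤T) (m+n≤o⇒n≤o K K+c≤T)
    where
    K+c≤T : K + c ≤ T
    K+c≤T = ≮⇒≥ λ T<K+c → <⇒≱ long (≤-sum (∈-map⁺ (length ∘ word) (∈-upTo⁺ T<K+c)))
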